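{- Suppose the following statement (A) holds: (A) There exist integers $t$ and $k_0$ such that for every integer $k \geq k_0$ and every real $c>0$ there is $n_0$ such that every (simple) graph on $n \geq n_0$ vertices with at least $c\, n^{3/2}$ edges contains a subgraph isomorphic to some graph $H \in \mathcal{H}_{k,t}$. Then the following statement (B) holds: (B) There exists an absolute constant $d$ such that for every positive integer $e$ and every real $c>0$ there is $N$ such that every $3$-uniform hypergraph on $n \geq N$ vertices with at least $c\, n^2$ hyperedges contains an $(e+d,e)$-configuration, i.e. a set of $e$ hyperedges whose union has at most $e+d$ vertices.
   Context: A graph is $2$-degenerate if every subgraph of it has a vertex of degree at most $2$ (equivalently, its vertices can be ordered so that each vertex has at most $2$ neighbours preceding it). For integers $k,t$, $\mathcal{H}_{k,t}$ denotes the family of all $2$-degenerate graphs with exactly $k$ vertices and exactly $2k-t$ edges. A $(v,e)$-configuration in a $3$-uniform hypergraph is a set of $e$ hyperedges spanned by at most $v$ vertices. -}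

module Defs where

open import Data.Nat using (ℕ; zero; suc; _+_; _*_; _^_; _≤_; _<ᵇ_)
open import Data.Integer as ℤ using (ℤ; +_; _-_)
open import Data.Bool using (Bool; true; false; _∧_; if_then_else_)
open import Data.Fin using (Fin; toℕ)
open import Data.Fin.Subset using (Subset; ∣_∣; ⋃)
open import Data.List using (List; map; allFin; cartesianProductWith; length)
open import Data.Nat.ListAction using (sum)
open import Data.List.Membership.Propositional using (_∈_)
open import Data.List.Relation.Unary.All using (All)
open import Data.List.Relation.Unary.Unique.Propositional using (Unique)
open import Data.Product using (Σ; ∃; _×_)
open import Function.Definitions using (Injective)
open import Relation.Binary.PropositionalEquality using (_≡_)

record Graph (n : ℕ) : Set where
  field
    adj    : Fin n → Fin n → Bool
    symm   : ∀ i j → adj i j ≡ adj j i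
    irrefl : ∀ i → adj i i ≡ false
open Graph public

edgeCount : ∀ {n} → Graph n → ℕ
edgeCount {n} G = sum (cartesianProductWith
  (λ i j → if (toℕ i <ᵇ toℕ j) ∧ adj G i j then 1 else 0) (allFin n) (allFin n))

earlierNeighbours : ∀ {k} → Graph k → (Fin k → Fin k) → Fin k → ℕ
earlierNeighbours {k} H ord v =
  sum (map (λ u → if adj H u v ∧ (toℕ (ord u) <ᵇ toℕ (ord v)) then 1 else 0) (allFin k))

-- 2-degenerate: vertices can be linearly ordered (ord injective, hence a
-- permutation of Fin k) so each vertex has at most 2 earlier neighbours.
TwoDegenerate : ∀ {k} → Graph k → Set
TwoDegenerate {k} H =
  Σ (Fin k → Fin k) λ ord → Injective _≡_ _≡_ ord × (∀ v → earlierNeighbours H ord v ≤ 2)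

InH : (k : ℕ) (t : ℤ) → Graph k → Set
InH k t H = TwoDegenerate H × (+ edgeCount H ≡ + (2 * k) - t)

ContainsCopy : ∀ {n k} → Graph n → Graph k → Set
ContainsCopy {n} {k} G H = Σ (Fin k → Fin n) λ f → Injective _≡_ _≡_ f ×
  (∀ i j → adj H i j ≡ true → adj G (f i) (f j) ≡ true)

record Hypergraph3 (n : ℕ) : Set where
  field
    edges   : List (Subset n)
    unique  : Unique edges
    uniform : All (λ s → ∣ s ∣ ≡ 3) edges
open Hypergraph3 public

HasConfig : ∀ {n} → Hypergraph3 n → ℕ → ℕ → Set
HasConfig {n} 𝓗 v e = Σ (List (Subset n)) λ F →
  length F ≡ e × Unique F × All (_∈ edges 𝓗) F × ∣ ⋃ F ∣ ≤ v

-- (A): the real constant c > 0 is taken as a positive rational p/q;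
-- |E| ≥ (p/q) n^{3/2}  ⟺  q²|E|² ≥ p² n³.
StatementA : Set
StatementA = Σ ℤ λ t → Σ ℕ λ k₀ → ∀ k → k₀ ≤ k →
  ∀ (p q : ℕ) → 1 ≤ p → 1 ≤ q → Σ ℕ λ n₀ → ∀ n → n₀ ≤ n → (G : Graph n) →
  p ^ 2 * n ^ 3 ≤ q ^ 2 * edgeCount G ^ 2 →
  Σ (Graph k) λ H → InH k t H × ContainsCopy G H

-- (B): |E| ≥ (p/q) n²  ⟺  q|E| ≥ p n².
StatementB : Set
StatementB = Σ ℕ λ d → ∀ (e : ℕ) → 1 ≤ e →
  ∀ (p q : ℕ) → 1 ≤ p → 1 ≤ q → Σ ℕ λ N → ∀ n → N ≤ n → (𝓗 : Hypergraph3 n) →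
  p * n ^ 2 ≤ q * length (edges 𝓗) →
  HasConfig 𝓗 (e + d) e

{-# OPTIONS --safe #-}

-- Write each hyperedge as a triple lo < mid < hi. If e hyperedges each share two vertices with a
-- fixed one, they span at most e + 3 vertices; otherwise a maximal linear subfamily T still has a
-- positive proportion of the hyperedges. Let G be the graph on pairs of vertices in which
-- (lo s , lo s′) and (mid s , mid s′) are adjacent whenever s ≠ s′ are triples of T with the same hi.
-- It has N = n² vertices and, by Cauchy–Schwarz, on the order of n³ = N^(3/2) edges, so (A) yields a
-- 2-degenerate H inside it. Adding the vertices of H in degenerate order, a vertex with b earlier
-- neighbours brings in at most 2 + b vertices of the hypergraph (the pair and one apex for each
-- neighbour) and 2b triples; a case distinction on which of them are already present shows that the
-- vertices outnumber the triples by at most the sum of the deficits 2 − b, which is at most |t|.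
-- Every step adds at most four triples, so one can stop between e and e + 3 triples.
module Submission where

open import Data.Bool using (Bool; true; false; if_then_else_; _∧_; _∨_)
open import Data.Bool.Properties as Bool using (∨-comm; T-≡)
open import Data.Fin as Fin using (Fin; zero; suc; toℕ; combine; remQuot)
import Data.Fin.Properties as Fin
open import Data.Fin.Subset using (Subset; inside; outside; ⊥; ⁅_⁆; _∪_; ⋃; ∣_∣) renaming (_∈_ to _∈ₛ_)
open import Data.Fin.Subset.Properties using (∣⊥∣≡0; ∣⁅x⁆∣≡1; p⊆q⇒∣p∣≤∣q∣; x∈⁅x⁆; x∈⁅y⁆⇒x≡y; x∈p∪q⁻; x∈p∪q⁺; ∪-identityˡ; ∉⊥)
open import Data.Integer as ℤ using ()
import Data.Integer.Properties as ℤ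
open import Data.List using (List; []; _∷_; _++_; map; length; filter; take; concatMap; allFin; cartesianProduct; cartesianProductWith)
open import Data.List.Membership.Propositional using (_∈_; _∉_; find)
open import Data.List.Membership.Propositional.Properties using (∈-∃++; ∈-map⁺; ∈-map⁻; ∈-filter⁺; ∈-filter⁻; ∈-allFin; ∈-cartesianProduct⁺; ∈-cartesianProduct⁻; ∈-concatMap⁺; ∈-++⁺ˡ; ∈-++⁺ʳ; ∈-++⁻)
open import Data.List.Properties using (map-++; map-id; length-++; length-map; length-take; length-tabulate)
open import Data.List.Relation.Binary.Subset.Propositional using (_⊆_)
open import Data.List.Relation.Unary.All as All using (All; []; _∷_)
import Data.List.Relation.Unary.All.Properties as All
open import Data.List.Relation.Unary.AllPairs using ([]; _∷_)
open import Data.List.Relation.Unary.Any as Any using (Any; here; there; any?)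
open import Data.List.Relation.Unary.Unique.Propositional using (Unique)
import Data.List.Relation.Unary.Unique.Propositional.Properties as Unique
open import Data.Nat using (ℕ; zero; suc; _+_; _*_; _∸_; _^_; _≤_; _<_; z≤n; s≤s; _≤?_; _<ᵇ_; >-nonZero)
open import Data.Nat.ListAction using (sum)
open import Data.Nat.ListAction.Properties using (sum-++)
open import Data.Nat.Properties
open import Data.Nat.Tactic.RingSolver using (solve-∀)
open import Data.Product using (Σ; ∃; ∃₂; _×_; _,_; proj₁; proj₂)
open import Data.Product.Properties using (≡-dec)
open import Data.Sum using (_⊎_; inj₁; inj₂)
import Data.Vec as Vec
open import Function using (_∘_; id; case_of_; Equivalence)
open import Relation.Binary.Definitions using (DecidableEquality; tri<; tri≈; tri>)
open import Relation.Binary.PropositionalEquality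
open import Relation.Nullary using (Dec; yes; no; does; contradiction)
open import Relation.Nullary.Decidable using (¬?; _×-dec_; dec-true; dec-false)
open import Relation.Unary using (Decidable)

open import Defs

private variable
  A B C : Set
  n : ℕ

-- Finite sums

∑ : List A → (A → ℕ) → ℕ
∑ xs f = sum (map f xs)

⟦_⟧ : Bool → ℕ
⟦ b ⟧ = if b then 1 else 0

∑-mono : ∀ (xs : List A) {f g : A → ℕ} → (∀ x → f x ≤ g x) → ∑ xs f ≤ ∑ xs g
∑-mono []       f≤g = z≤n
∑-mono (x ∷ xs) f≤g = +-mono-≤ (f≤g x) (∑-mono xs f≤g)

∑-mono-∈ : ∀ (xs : List A) {f g : A → ℕ} → All (λ x → f x ≤ g x) xs → ∑ xs f ≤ ∑ xs g
∑-mono-∈ []       []           = z≤n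
∑-mono-∈ (x ∷ xs) (fx≤gx ∷ f≤g) = +-mono-≤ fx≤gx (∑-mono-∈ xs f≤g)

∑-cong : ∀ (xs : List A) {f g : A → ℕ} → (∀ x → f x ≡ g x) → ∑ xs f ≡ ∑ xs g
∑-cong []       f≡g = refl
∑-cong (x ∷ xs) f≡g = cong₂ _+_ (f≡g x) (∑-cong xs f≡g)

∑-distrib-+ : ∀ (xs : List A) (f g : A → ℕ) → ∑ xs (λ x → f x + g x) ≡ ∑ xs f + ∑ xs g
∑-distrib-+ []       f g = refl
∑-distrib-+ (x ∷ xs) f g = trans (cong (f x + g x +_) (∑-distrib-+ xs f g)) (interchange (f x) (g x) _ _)
  where
  interchange : ∀ a b c d → (a + b) + (c + d) ≡ (a + c) + (b + d)
  interchange = solve-∀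

∑-*ʳ : ∀ (xs : List A) (f : A → ℕ) c → ∑ xs (λ x → f x * c) ≡ ∑ xs f * c
∑-*ʳ []       f c = refl
∑-*ʳ (x ∷ xs) f c = trans (cong (f x * c +_) (∑-*ʳ xs f c)) (sym (*-distribʳ-+ c (f x) _))

∑-const : ∀ (xs : List A) c → ∑ xs (λ _ → c) ≡ length xs * c
∑-const []       c = refl
∑-const (x ∷ xs) c = cong (c +_) (∑-const xs c)

∑-one : ∀ (xs : List A) → ∑ xs (λ _ → 1) ≡ length xs
∑-one xs = trans (∑-const xs 1) (*-identityʳ _)

∑-swap : ∀ (xs : List A) (ys : List B) (f : A → B → ℕ) →
  ∑ xs (λ x → ∑ ys (f x)) ≡ ∑ ys (λ y → ∑ xs (λ x → f x y))
∑-swap []       ys f = sym (trans (∑-const ys 0) (*-zeroʳ (length ys)))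
∑-swap (x ∷ xs) ys f = trans (cong (∑ ys (f x) +_) (∑-swap xs ys f)) (sym (∑-distrib-+ ys (f x) _))

∑-++ : ∀ (xs ys : List A) f → ∑ (xs ++ ys) f ≡ ∑ xs f + ∑ ys f
∑-++ xs ys f = trans (cong sum (map-++ f xs ys)) (sum-++ (map f xs) (map f ys))

∑-map : ∀ (g : A → B) (xs : List A) f → ∑ (map g xs) f ≡ ∑ xs (f ∘ g)
∑-map g []       f = refl
∑-map g (x ∷ xs) f = cong (f (g x) +_) (∑-map g xs f)

∑-cartesianProductWith : ∀ (g : A → B → C) xs ys f →
  ∑ (cartesianProductWith g xs ys) f ≡ ∑ xs (λ x → ∑ ys (λ y → f (g x y)))
∑-cartesianProductWith g []       ys f = refl
∑-cartesianProductWith g (x ∷ xs) ys f =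
  trans (∑-++ (map (g x) ys) _ f) (cong₂ _+_ (∑-map (g x) ys f) (∑-cartesianProductWith g xs ys f))

sum-cartesianProductWith : ∀ (g : A → B → ℕ) xs ys →
  sum (cartesianProductWith g xs ys) ≡ ∑ xs (λ x → ∑ ys (g x))
sum-cartesianProductWith g xs ys =
  trans (cong sum (sym (map-id (cartesianProductWith g xs ys)))) (∑-cartesianProductWith g xs ys id)

length-cartesianProduct : ∀ (xs : List A) (ys : List B) →
  length (cartesianProduct xs ys) ≡ length xs * length ys
length-cartesianProduct xs ys = trans (sym (∑-one (cartesianProduct xs ys))) (trans (∑-cartesianProductWith _,_ xs ys (λ _ → 1))
  (trans (∑-cong xs (λ _ → ∑-one ys)) (∑-const xs (length ys))))

length-concatMap : ∀ (f : A → List B) xs → length (concatMap f xs) ≡ ∑ xs (length ∘ f)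
length-concatMap f []       = refl
length-concatMap f (x ∷ xs) = trans (length-++ (f x)) (cong (length (f x) +_) (length-concatMap f xs))

length-filter-∑ : ∀ {P : A → Set} (P? : Decidable P) xs →
  length (filter P? xs) ≡ ∑ xs (λ x → ⟦ does (P? x) ⟧)
length-filter-∑ P? []       = refl
length-filter-∑ P? (x ∷ xs) with does (P? x)
... | true  = cong suc (length-filter-∑ P? xs)
... | false = length-filter-∑ P? xs

-- Each entry of `xs` is matched with an occurrence in `ys`, which is then cut out; as `xs` has no
-- repetition, its remaining entries still occur in what is left.
∑-⊆ : ∀ {xs ys : List A} f → Unique xs → xs ⊆ ys → ∑ xs f ≤ ∑ ys f
∑-⊆ {xs = []}     f []            xs⊆ys = z≤n
∑-⊆ {xs = x ∷ xs} f (x∉xs ∷ xs!) xs⊆ys with ∈-∃++ (xs⊆ys (here refl))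
... | us , vs , refl = begin
  f x + ∑ xs f            ≤⟨ +-monoʳ-≤ (f x) (∑-⊆ f xs! xs⊆us++vs) ⟩
  f x + ∑ (us ++ vs) f    ≡⟨ cong (f x +_) (∑-++ us vs f) ⟩
  f x + (∑ us f + ∑ vs f) ≡⟨ rotate (f x) (∑ us f) (∑ vs f) ⟩
  ∑ us f + (f x + ∑ vs f) ≡⟨ ∑-++ us (x ∷ vs) f ⟨
  ∑ (us ++ x ∷ vs) f      ∎
  where
  open ≤-Reasoning
  rotate : ∀ a b c → a + (b + c) ≡ b + (a + c)
  rotate = solve-∀
  xs⊆us++vs : xs ⊆ us ++ vs
  xs⊆us++vs y∈xs with ∈-++⁻ us (xs⊆ys (there y∈xs))
  ... | inj₁ y∈us         = ∈-++⁺ˡ y∈us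
  ... | inj₂ (here refl)  = contradiction refl (All.lookup x∉xs y∈xs)
  ... | inj₂ (there y∈vs) = ∈-++⁺ʳ us y∈vs

length-⊆ : ∀ {xs ys : List A} → Unique xs → xs ⊆ ys → length xs ≤ length ys
length-⊆ {xs = xs} {ys} xs! xs⊆ys = subst₂ _≤_ (∑-one xs) (∑-one ys) (∑-⊆ _ xs! xs⊆ys)

module _ (_≟_ : DecidableEquality A) where

  ∑-δ-∉ : ∀ {a} {xs : List A} (f : A → ℕ) → All (a ≢_) xs → ∑ xs (λ x → ⟦ does (a ≟ x) ⟧ * f x) ≡ 0
  ∑-δ-∉ f []           = refl
  ∑-δ-∉ {a} {x ∷ _} f (a≢x ∷ a∉xs) with a ≟ x
  ... | yes a≡x = contradiction a≡x a≢x
  ... | no  _   = ∑-δ-∉ f a∉xs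

  ∑-δ-≤ : ∀ a {xs : List A} (f : A → ℕ) → Unique xs → ∑ xs (λ x → ⟦ does (a ≟ x) ⟧ * f x) ≤ f a
  ∑-δ-≤ a f [] = z≤n
  ∑-δ-≤ a {x ∷ xs} f (x∉xs ∷ xs!) with a ≟ x
  ... | yes refl = ≤-reflexive (trans (cong₂ _+_ (*-identityˡ (f a)) (∑-δ-∉ f x∉xs)) (+-identityʳ _))
  ... | no  _    = ∑-δ-≤ a f xs!

  ∑-δ-∈ : ∀ {a} {xs : List A} → a ∈ xs → 1 ≤ ∑ xs (λ x → ⟦ does (a ≟ x) ⟧)
  ∑-δ-∈ {a} {x ∷ _} (here a≡x) with a ≟ x
  ... | yes _   = s≤s z≤n
  ... | no  a≢x = contradiction a≡x a≢x
  ∑-δ-∈ (there a∈xs) = m≤n⇒m≤o+n _ (∑-δ-∈ a∈xs)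

-- The Cauchy-Schwarz inequality and the number of collisions

am-gm : ∀ a b → 2 * (a * b) ≤ a * a + b * b
am-gm a b with ≤-total a b
-- With b = a + c the two sides differ by c².
... | inj₁ a≤b = subst (λ b → 2 * (a * b) ≤ a * a + b * b) (m+[n∸m]≡n a≤b)
  (subst₂ _≤_ refl (square a (b ∸ a)) (m≤m+n _ _))
  where
  square : ∀ a c → 2 * (a * (a + c)) + c * c ≡ a * a + (a + c) * (a + c)
  square = solve-∀
... | inj₂ b≤a = subst (λ a → 2 * (a * b) ≤ a * a + b * b) (m+[n∸m]≡n b≤a)
  (subst₂ _≤_ refl (square b (a ∸ b)) (m≤m+n _ _))
  where
  square : ∀ b c → 2 * ((b + c) * b) + c * c ≡ (b + c) * (b + c) + b * b
  square = solve-∀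

-- By induction on the list: the cross term between the head and the tail is bounded summand by
-- summand with `am-gm`.
cauchy-schwarz : ∀ (xs : List A) (f : A → ℕ) →
  ∑ xs f * ∑ xs f ≤ length xs * ∑ xs (λ x → f x * f x)
cauchy-schwarz []       f = z≤n
cauchy-schwarz {A = A} (x ∷ xs) f = begin
  (f x + ∑ xs f) * (f x + ∑ xs f)
    ≡⟨ expand (f x) (∑ xs f) ⟩
  f x * f x + (2 * (f x * ∑ xs f) + ∑ xs f * ∑ xs f)
    ≤⟨ +-monoʳ-≤ (f x * f x) (+-mono-≤ (cross xs) (cauchy-schwarz xs f)) ⟩
  f x * f x + (length xs * (f x * f x) + Q + length xs * Q)
    ≡⟨ collect (f x) (length xs) Q ⟩
  suc (length xs) * (f x * f x + Q) ∎
  where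
  open ≤-Reasoning
  Q = ∑ xs (λ x → f x * f x)
  expand : ∀ a s → (a + s) * (a + s) ≡ a * a + (2 * (a * s) + s * s)
  expand = solve-∀
  collect : ∀ a l q → a * a + (l * (a * a) + q + l * q) ≡ (1 + l) * (a * a + q)
  collect = solve-∀
  distrib : ∀ a b s → 2 * (a * (b + s)) ≡ 2 * (a * b) + 2 * (a * s)
  distrib = solve-∀
  regroup : ∀ a b l q → a * a + b * b + (l * (a * a) + q) ≡ (1 + l) * (a * a) + (b * b + q)
  regroup = solve-∀
  cross : ∀ (ys : List A) → 2 * (f x * ∑ ys f) ≤ length ys * (f x * f x) + ∑ ys (λ y → f y * f y)
  cross []       = ≤-reflexive (cong (2 *_) (*-zeroʳ (f x)))
  cross (y ∷ ys) = subst₂ _≤_ (sym (distrib (f x) (f y) (∑ ys f)))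
    (regroup (f x) (f y) (length ys) _) (+-mono-≤ (am-gm (f x) (f y)) (cross ys))

-- Cauchy–Schwarz for the sizes of the fibres of h.
collisions : ∀ (xs : List A) (h : A → Fin n) →
  length xs * length xs ≤ n * ∑ xs (λ x → ∑ xs (λ y → ⟦ does (h x Fin.≟ h y) ⟧))
collisions {n = n} xs h = begin
  length xs * length xs
    ≤⟨ *-mono-≤ m≤∑d m≤∑d ⟩
  ∑ (allFin n) d * ∑ (allFin n) d
    ≤⟨ cauchy-schwarz (allFin n) d ⟩
  length (allFin n) * ∑ (allFin n) (λ z → d z * d z)
    ≡⟨ cong (_* ∑ (allFin n) (λ z → d z * d z)) (length-tabulate {n = n} id) ⟩
  n * ∑ (allFin n) (λ z → d z * d z)
    -- One factor `d z` is opened into a sum over `xs`; after the exchange of sums the delta leaves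
    -- only z = h x.
    ≡⟨ cong (n *_) (∑-cong (allFin n) (λ z → ∑-*ʳ xs (λ x → ⟦ does (h x Fin.≟ z) ⟧) (d z))) ⟨
  n * ∑ (allFin n) (λ z → ∑ xs (λ x → ⟦ does (h x Fin.≟ z) ⟧ * d z))
    ≡⟨ cong (n *_) (∑-swap (allFin n) xs _) ⟩
  n * ∑ xs (λ x → ∑ (allFin n) (λ z → ⟦ does (h x Fin.≟ z) ⟧ * d z))
    ≤⟨ *-monoʳ-≤ n (∑-mono xs (λ x → ∑-δ-≤ Fin._≟_ (h x) d (Unique.allFin⁺ n))) ⟩
  n * ∑ xs (λ x → d (h x))
    ≡⟨ cong (n *_) (∑-swap xs xs (λ x y → ⟦ does (h y Fin.≟ h x) ⟧)) ⟩
  n * ∑ xs (λ x → ∑ xs (λ y → ⟦ does (h x Fin.≟ h y) ⟧)) ∎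
  where
  open ≤-Reasoning
  d : Fin n → ℕ
  d z = ∑ xs (λ x → ⟦ does (h x Fin.≟ z) ⟧)
  m≤∑d : length xs ≤ ∑ (allFin n) d
  m≤∑d = begin
    length xs                                                ≡⟨ ∑-one xs ⟨
    ∑ xs (λ _ → 1)                                           ≤⟨ ∑-mono xs (λ x → ∑-δ-∈ Fin._≟_ (∈-allFin (h x))) ⟩
    ∑ xs (λ x → ∑ (allFin n) (λ z → ⟦ does (h x Fin.≟ z) ⟧)) ≡⟨ ∑-swap xs (allFin n) _ ⟩
    ∑ (allFin n) d                                           ∎

-- Lists without repetition

-- Injectivity is asked for on the list only, because `toSet` and `ends` are injective on the lists
-- in question but not on all triples or pairs of triples.
unique-map-∈ : ∀ {f : A → B} {xs} → Unique xs →
  (∀ {x y} → x ∈ xs → y ∈ xs → f x ≡ f y → x ≡ y) → Unique (map f xs)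
unique-map-∈ []           inj = []
unique-map-∈ (x∉xs ∷ xs!) inj =
  All.map⁺ (All.tabulate λ y∈xs fx≡fy → All.lookup x∉xs y∈xs (inj (here refl) (there y∈xs) fx≡fy))
  ∷ unique-map-∈ xs! (λ p q → inj (there p) (there q))

unique-map⇒injective : ∀ {f : A → B} {xs x y} → Unique (map f xs) → x ∈ xs → y ∈ xs → f x ≡ f y → x ≡ y
unique-map⇒injective _ (here refl) (here refl) _ = refl
unique-map⇒injective {f = f} (fx∉ ∷ _) (here refl) (there y∈) eq = contradiction eq (All.lookup fx∉ (∈-map⁺ f y∈))
unique-map⇒injective {f = f} (fy∉ ∷ _) (there x∈) (here refl) eq = contradiction (sym eq) (All.lookup fy∉ (∈-map⁺ f x∈))
unique-map⇒injective (_ ∷ u) (there x∈) (there y∈) eq = unique-map⇒injective u x∈ y∈ eq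

module Insert (_≟_ : DecidableEquality A) where

  open import Data.List.Membership.DecPropositional _≟_ using (_∈?_)

  -- Lists stand for finite sets: an element already present is not added again, so a growth in
  -- length counts the genuinely new elements.
  insert : A → List A → List A
  insert x xs with x ∈? xs
  ... | yes _ = xs
  ... | no  _ = x ∷ xs

  ∈-insert : ∀ x xs → x ∈ insert x xs
  ∈-insert x xs with x ∈? xs
  ... | yes x∈xs = x∈xs
  ... | no  _    = here refl

  ⊆-insert : ∀ x xs → xs ⊆ insert x xs
  ⊆-insert x xs y∈xs with x ∈? xs
  ... | yes _ = y∈xs
  ... | no  _ = there y∈xs

  ∈-insert⁻ : ∀ x xs {y} → y ∈ insert x xs → y ≡ x ⊎ y ∈ xs
  ∈-insert⁻ x xs y∈ with x ∈? xs
  ∈-insert⁻ x xs y∈         | yes _ = inj₂ y∈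
  ∈-insert⁻ x xs (here eq)  | no  _ = inj₁ eq
  ∈-insert⁻ x xs (there y∈) | no  _ = inj₂ y∈

  insert-All : ∀ {P : A → Set} x xs → P x → All P xs → All P (insert x xs)
  insert-All x xs px pxs with x ∈? xs
  ... | yes _ = pxs
  ... | no  _ = px ∷ pxs

  insert-Unique : ∀ x xs → Unique xs → Unique (insert x xs)
  insert-Unique x xs xs! with x ∈? xs
  ... | yes _    = xs!
  ... | no  x∉xs = All.tabulate (λ y∈xs x≡y → x∉xs (subst (_∈ xs) (sym x≡y) y∈xs)) ∷ xs!

  length-insert-≥ : ∀ x xs → length xs ≤ length (insert x xs)
  length-insert-≥ x xs with x ∈? xs
  ... | yes _ = ≤-refl
  ... | no  _ = n≤1+n _

  length-insert-≤ : ∀ x xs → length (insert x xs) ≤ suc (length xs)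
  length-insert-≤ x xs with x ∈? xs
  ... | yes _ = n≤1+n _
  ... | no  _ = ≤-refl

  length-insert-∉ : ∀ {x xs} → x ∉ xs → length (insert x xs) ≡ suc (length xs)
  length-insert-∉ {x} {xs} x∉xs with x ∈? xs
  ... | yes x∈xs = contradiction x∈xs x∉xs
  ... | no  _    = refl

-- Hyperedges as triples lo < mid < hi

∣p∪q∣≤∣p∣+∣q∣ : ∀ (p q : Subset n) → ∣ p ∪ q ∣ ≤ ∣ p ∣ + ∣ q ∣
∣p∪q∣≤∣p∣+∣q∣ Vec.[]              Vec.[]              = z≤n
∣p∪q∣≤∣p∣+∣q∣ (outside Vec.∷ p) (outside Vec.∷ q) = ∣p∪q∣≤∣p∣+∣q∣ p q
∣p∪q∣≤∣p∣+∣q∣ (outside Vec.∷ p) (inside Vec.∷ q) =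
  ≤-trans (s≤s (∣p∪q∣≤∣p∣+∣q∣ p q)) (≤-reflexive (sym (+-suc ∣ p ∣ ∣ q ∣)))
∣p∪q∣≤∣p∣+∣q∣ (inside Vec.∷ p) (outside Vec.∷ q) = s≤s (∣p∪q∣≤∣p∣+∣q∣ p q)
∣p∪q∣≤∣p∣+∣q∣ (inside Vec.∷ p) (inside Vec.∷ q) =
  s≤s (≤-trans (∣p∪q∣≤∣p∣+∣q∣ p q) (+-monoʳ-≤ ∣ p ∣ (n≤1+n ∣ q ∣)))

-- The union of `F` lies in the union of the singletons of `W`, which subadditivity bounds by the
-- length of `W`, repetitions allowed.
∣⋃∣≤length : ∀ (F : List (Subset n)) (W : List (Fin n)) →
  All (λ s → ∀ {x} → x ∈ₛ s → x ∈ W) F → ∣ ⋃ F ∣ ≤ length W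
∣⋃∣≤length {n} F W F⊑W = ≤-trans (p⊆q⇒∣p∣≤∣q∣ λ x∈ → ∈⇒∈ₛ (covered F⊑W x∈)) (size W)
  where
  ∈⇒∈ₛ : ∀ {V x} → x ∈ V → x ∈ₛ ⋃ (map ⁅_⁆ V)
  ∈⇒∈ₛ (here refl) = x∈p∪q⁺ (inj₁ (x∈⁅x⁆ _))
  ∈⇒∈ₛ (there x∈V) = x∈p∪q⁺ (inj₂ (∈⇒∈ₛ x∈V))
  covered : ∀ {F} → All (λ s → ∀ {x} → x ∈ₛ s → x ∈ W) F → ∀ {x} → x ∈ₛ ⋃ F → x ∈ W
  covered []           x∈ = contradiction x∈ ∉⊥
  covered (s⊑W ∷ F⊑W) x∈ with x∈p∪q⁻ _ _ x∈
  ... | inj₁ x∈s = s⊑W x∈s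
  ... | inj₂ x∈F = covered F⊑W x∈F
  size : ∀ V → ∣ ⋃ (map ⁅_⁆ V) ∣ ≤ length V
  size []      = ≤-reflexive (∣⊥∣≡0 n)
  size (v ∷ V) = ≤-trans (∣p∪q∣≤∣p∣+∣q∣ ⁅ v ⁆ _) (+-mono-≤ (≤-reflexive (∣⁅x⁆∣≡1 v)) (size V))

Triple : ℕ → Set
Triple n = Fin n × Fin n × Fin n

lo mid hi : Triple n → Fin n
lo  (a , _ , _) = a
mid (_ , b , _) = b
hi  (_ , _ , c) = c

_≟₃_ : DecidableEquality (Triple n)
_≟₃_ = ≡-dec Fin._≟_ (≡-dec Fin._≟_ Fin._≟_)

Increasing : Triple n → Set
Increasing t = lo t Fin.< mid t × mid t Fin.< hi t

vertices : Triple n → List (Fin n)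
vertices t = lo t ∷ mid t ∷ hi t ∷ []

infix 4 _⊑_
_⊑_ : Triple n → List (Fin n) → Set
t ⊑ W = All (_∈ W) (vertices t)

⊑-⊆ : ∀ {t : Triple n} {V W} → V ⊆ W → t ⊑ V → t ⊑ W
⊑-⊆ V⊆W = All.map V⊆W

toSet : Triple n → Subset n
toSet (a , b , c) = ⁅ a ⁆ ∪ (⁅ b ⁆ ∪ ⁅ c ⁆)

∈toSet⇒∈ : ∀ {W} (t : Triple n) → t ⊑ W → ∀ {x} → x ∈ₛ toSet t → x ∈ W
∈toSet⇒∈ t (a∈ ∷ b∈ ∷ c∈ ∷ []) x∈ with x∈p∪q⁻ _ _ x∈
... | inj₁ x∈a rewrite x∈⁅y⁆⇒x≡y _ x∈a = a∈
... | inj₂ x∈bc with x∈p∪q⁻ _ _ x∈bc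
...   | inj₁ x∈b rewrite x∈⁅y⁆⇒x≡y _ x∈b = b∈
...   | inj₂ x∈c rewrite x∈⁅y⁆⇒x≡y _ x∈c = c∈

∣p∣≡0⇒p≡⊥ : ∀ (p : Subset n) → ∣ p ∣ ≡ 0 → p ≡ ⊥
∣p∣≡0⇒p≡⊥ Vec.[]            eq = refl
∣p∣≡0⇒p≡⊥ (outside Vec.∷ p) eq = cong (outside Vec.∷_) (∣p∣≡0⇒p≡⊥ p eq)

∣p∣≡1⇒singleton : ∀ (p : Subset n) → ∣ p ∣ ≡ 1 → ∃ λ a → p ≡ ⁅ a ⁆
∣p∣≡1⇒singleton (outside Vec.∷ p) eq with a , refl ← ∣p∣≡1⇒singleton p eq = suc a , refl
∣p∣≡1⇒singleton (inside  Vec.∷ p) eq =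
  zero , cong (inside Vec.∷_) (∣p∣≡0⇒p≡⊥ p (suc-injective eq))

∣p∣≡2⇒pair : ∀ (p : Subset n) → ∣ p ∣ ≡ 2 → ∃₂ λ a b → a Fin.< b × p ≡ ⁅ a ⁆ ∪ ⁅ b ⁆
∣p∣≡2⇒pair (outside Vec.∷ p) eq with a , b , a<b , refl ← ∣p∣≡2⇒pair p eq =
  suc a , suc b , s≤s a<b , refl
∣p∣≡2⇒pair (inside  Vec.∷ p) eq with b , refl ← ∣p∣≡1⇒singleton p (suc-injective eq) =
  zero , suc b , s≤s z≤n , cong (inside Vec.∷_) (sym (∪-identityˡ _))

-- Scanning the vector from the left meets the elements in increasing order.
∣p∣≡3⇒triple : ∀ (p : Subset n) → ∣ p ∣ ≡ 3 → ∃ λ t → Increasing t × p ≡ toSet t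
∣p∣≡3⇒triple (outside Vec.∷ p) eq with (a , b , c) , (a<b , b<c) , refl ← ∣p∣≡3⇒triple p eq =
  (suc a , suc b , suc c) , (s≤s a<b , s≤s b<c) , refl
∣p∣≡3⇒triple (inside  Vec.∷ p) eq with b , c , b<c , refl ← ∣p∣≡2⇒pair p (suc-injective eq) =
  (zero , suc b , suc c) , (s≤s z≤n , s≤s b<c) , cong (inside Vec.∷_) (sym (∪-identityˡ _))

triples : ∀ (E : List (Subset n)) → All (λ s → ∣ s ∣ ≡ 3) E →
  ∃ λ T → All Increasing T × E ≡ map toSet T
triples []      []          = [] , [] , refl
triples (s ∷ E) (∣s∣ ∷ ∣E∣) with ∣p∣≡3⇒triple s ∣s∣ | triples E ∣E∣
... | t , t↑ , refl | T , T↑ , refl = t ∷ T , t↑ ∷ T↑ , refl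

-- Configurations of triples

record Subconfiguration (T : List (Triple n)) (W : List (Fin n)) (F : List (Triple n)) : Set where
  field
    unique!  : Unique F
    included : All (_∈ T) F
    covered  : All (_⊑ W) F
open Subconfiguration public

Configuration : List (Triple n) → ℕ → ℕ → Set
Configuration T v e = ∃₂ λ W F → Subconfiguration T W F × e ≤ length F × length W ≤ v

-- The first `e` triples are kept. They stay distinct as sets because `toSet` maps `T` onto the edge
-- list, which has no repetition.
configuration⇒hasConfig : ∀ (𝓗 : Hypergraph3 n) {T v e} → edges 𝓗 ≡ map toSet T →
  Configuration T v e → HasConfig 𝓗 v e
configuration⇒hasConfig 𝓗 {T} {v} {e} E≡T (W , F , C , e≤F , W≤v) =
  map toSet F′ ,
  trans (length-map toSet F′) (trans (length-take e F) (m≤n⇒m⊓n≡m e≤F)) ,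
  unique-map-∈ (Unique.take⁺ e (unique! C))
    (λ s∈ t∈ → unique-map⇒injective (subst Unique E≡T (unique 𝓗)) (All.lookup F′⊆T s∈) (All.lookup F′⊆T t∈)) ,
  All.map⁺ (All.map (λ t∈T → subst (_ ∈_) (sym E≡T) (∈-map⁺ toSet t∈T)) F′⊆T) ,
  ≤-trans (∣⋃∣≤length (map toSet F′) W (All.map⁺ (All.map (∈toSet⇒∈ _) (All.take⁺ e (covered C))))) W≤v
  where
  F′ = take e F
  F′⊆T = All.take⁺ e (included C)

-- Linear subfamilies

Shares : Triple n → Triple n → Set
Shares s t = ∃₂ λ x y → x ≢ y × (x ∈ vertices s × y ∈ vertices s) × (x ∈ vertices t × y ∈ vertices t)

shares-sym : ∀ {s t : Triple n} → Shares s t → Shares t s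
shares-sym (x , y , x≢y , s , t) = x , y , x≢y , t , s

shares? : ∀ (s t : Triple n) → Dec (Shares s t)
shares? s t = Fin.any? λ x → Fin.any? λ y → ¬? (x Fin.≟ y)
  ×-dec ((x ∈? vertices s) ×-dec (y ∈? vertices s)) ×-dec ((x ∈? vertices t) ×-dec (y ∈? vertices t))
  where open import Data.List.Membership.DecPropositional Fin._≟_ using (_∈?_)

shares-refl : ∀ {t : Triple n} → Increasing t → Shares t t
shares-refl (a<b , _) = _ , _ , Fin.<⇒≢ a<b , (here refl , there (here refl)) , (here refl , there (here refl))

-- An increasing triple shares two vertices with itself, so the conclusion is equality and not
-- absurdity.
Linear : List (Triple n) → Set
Linear T = ∀ {s t} → s ∈ T → t ∈ T → Shares s t → s ≡ t

record LinearCore (T : List (Triple n)) : Set where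
  field
    core    : List (Triple n)
    core⊆   : core ⊆ T
    core!   : Unique core
    linear  : Linear core
    maximal : ∀ {s} → s ∈ T → Any (λ t → Shares t s) core

-- Greedy choice: a triple is kept exactly when it shares two vertices with none of those kept so
-- far.
linearCore : ∀ (T : List (Triple n)) → All Increasing T → LinearCore T
linearCore []      []        = record
  { core = [] ; core⊆ = λ () ; core! = [] ; linear = λ () ; maximal = λ () }
linearCore (s ∷ T) (s↑ ∷ T↑) with linearCore T T↑
... | record { core = L ; core⊆ = L⊆T ; core! = L! ; linear = lin ; maximal = max }
  with any? (λ t → shares? t s) L
...   | yes hit = record
  { core = L ; core⊆ = there ∘ L⊆T ; core! = L! ; linear = lin
  ; maximal = λ { (here refl) → hit ; (there r∈T) → max r∈T } }
...   | no miss = record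
  { core    = s ∷ L
  ; core⊆   = λ { (here refl) → here refl ; (there t∈L) → there (L⊆T t∈L) }
  ; core!   = All.tabulate (λ { t∈L refl → miss (Any.map (λ { refl → shares-refl s↑ }) t∈L) }) ∷ L!
  ; linear  = λ
    { (here refl) (here refl) _  → refl
    ; (here refl) (there t∈L) sh → contradiction (Any.map (λ { refl → shares-sym sh }) t∈L) miss
    ; (there r∈L) (here refl) sh → contradiction (Any.map (λ { refl → sh }) r∈L) miss
    ; (there r∈L) (there t∈L) sh → lin r∈L t∈L sh }
  ; maximal = λ { (here refl) → here (shares-refl s↑) ; (there r∈T) → there (max r∈T) }
  }

-- Two of the vertices of `s` already belong to `t`; the cases run over their positions in `s`, and
-- `z` is the remaining one.
third : ∀ {t s : Triple n} → Shares t s → ∃ λ z → s ⊑ z ∷ vertices t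
third {s = a , b , c} (x , y , x≢y , (x∈ , y∈) , (xs , ys)) with xs | ys
... | here refl                 | here refl                 = contradiction refl x≢y
... | here refl                 | there (here refl)         = c , there x∈ ∷ there y∈ ∷ here refl ∷ []
... | here refl                 | there (there (here refl)) = b , there x∈ ∷ here refl ∷ there y∈ ∷ []
... | there (here refl)         | here refl                 = c , there y∈ ∷ there x∈ ∷ here refl ∷ []
... | there (here refl)         | there (here refl)         = contradiction refl x≢y
... | there (here refl)         | there (there (here refl)) = a , here refl ∷ there x∈ ∷ there y∈ ∷ []
... | there (there (here refl)) | here refl                 = b , there y∈ ∷ here refl ∷ there x∈ ∷ []
... | there (there (here refl)) | there (here refl)         = a , here refl ∷ there y∈ ∷ there x∈ ∷ []
... | there (there (here refl)) | there (there (here refl)) = contradiction refl x≢y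

-- The centre contributes its three vertices and each further triple at most one more.
star-cover : ∀ (t : Triple n) F → All (Shares t) F →
  ∃ λ W → length W ≡ length F + 3 × vertices t ⊆ W × All (_⊑ W) F
star-cover t []      []        = vertices t , refl , id , []
star-cover t (s ∷ F) (sh ∷ shs) with star-cover t F shs | third sh
... | W , ∣W∣ , t⊆W , F⊑W | z , s⊑ = z ∷ W , cong suc ∣W∣ , there ∘ t⊆W ,
  ⊑-⊆ (λ { (here eq) → here eq ; (there x∈) → there (t⊆W x∈) }) s⊑ ∷ All.map (⊑-⊆ there) F⊑W

star-configuration : ∀ {T : List (Triple n)} {e} t → Unique T → e ≤ length (filter (shares? t) T) →
  Configuration T (e + 3) e
star-configuration {T = T} {e} t T! e≤ with
  star-cover t (take e (filter (shares? t) T)) (All.take⁺ e (All.all-filter (shares? t) T))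
... | W , ∣W∣ , _ , F⊑W = W , F , record
  { unique!  = Unique.take⁺ e (Unique.filter⁺ (shares? t) T!)
  ; included = All.take⁺ e (All.tabulate λ s∈ → proj₁ (∈-filter⁻ (shares? t) {xs = T} s∈))
  ; covered  = F⊑W } , ≤-reflexive (sym ∣F∣) , ≤-reflexive (trans ∣W∣ (cong (_+ 3) ∣F∣))
  where
  F = take e (filter (shares? t) T)
  ∣F∣ : length F ≡ e
  ∣F∣ = trans (length-take e _) (m≤n⇒m⊓n≡m e≤)

-- By maximality the stars around the core cover `T`. Either one of them has `e` members, or each
-- has fewer and the core must be large.
star-or-large-core : ∀ {T : List (Triple n)} e → Unique T → (L : LinearCore T) →
  Configuration T (e + 3) e ⊎ length T ≤ length (LinearCore.core L) * e
star-or-large-core {T = T} e T! L with any? (λ t → e ≤? length (filter (shares? t) T)) (LinearCore.core L)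
... | yes big with t , _ , e≤ ← find big = inj₁ (star-configuration t T! e≤)
... | no small = inj₂ (begin
  length T                                             ≤⟨ length-⊆ T! T⊆stars ⟩
  length (concatMap (λ t → filter (shares? t) T) core) ≡⟨ length-concatMap _ core ⟩
  ∑ core (λ t → length (filter (shares? t) T))         ≤⟨ ∑-mono-∈ core (All.map (<⇒≤ ∘ ≰⇒>) (All.¬Any⇒All¬ core small)) ⟩
  ∑ core (λ _ → e)                                     ≡⟨ ∑-const core e ⟩
  length core * e                                      ∎)
  where
  open ≤-Reasoning
  open LinearCore L
  T⊆stars : T ⊆ concatMap (λ t → filter (shares? t) T) core
  T⊆stars s∈T = ∈-concatMap⁺ _ (Any.map (∈-filter⁺ (shares? _) s∈T) (maximal s∈T))

-- The graph of pairs

does-≟-true : ∀ b → does (b Bool.≟ true) ≡ b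
does-≟-true true  = refl
does-≟-true false = refl

module _ {m : ℕ} (D : List (Fin m × Fin m)) (D< : ∀ {i j} → (i , j) ∈ D → i Fin.< j) where

  open import Data.List.Membership.DecPropositional (≡-dec (Fin._≟_ {m}) (Fin._≟_ {m})) using (_∈?_)

  fromEdges : Graph m
  fromEdges = record
    { adj    = λ i j → does ((i , j) ∈? D) ∨ does ((j , i) ∈? D)
    ; symm   = λ i j → ∨-comm (does ((i , j) ∈? D)) _
    ; irrefl = λ i → cong₂ _∨_ (loop i) (loop i)
    }
    where
    loop : ∀ i → does ((i , i) ∈? D) ≡ false
    loop i = dec-false ((i , i) ∈? D) (λ ii∈D → Fin.<-irrefl refl (D< ii∈D))

  fromEdges-adj⁻ : ∀ {i j} → adj fromEdges i j ≡ true → (i , j) ∈ D ⊎ (j , i) ∈ D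
  fromEdges-adj⁻ {i} {j} eq with (i , j) ∈? D | (j , i) ∈? D
  ... | yes ij∈D | _        = inj₁ ij∈D
  ... | no  _    | yes ji∈D = inj₂ ji∈D

  -- The entries of `D` are increasing pairs, so each is among the pairs i < j inspected by
  -- `edgeCount`.
  fromEdges-edgeCount : Unique D → length D ≤ edgeCount fromEdges
  fromEdges-edgeCount D! = begin
    length D                            ≤⟨ length-⊆ D! D⊆E ⟩
    length (filter isEdge? pairs)       ≡⟨ length-filter-∑ isEdge? pairs ⟩
    ∑ pairs (λ p → ⟦ does (isEdge? p) ⟧) ≡⟨ ∑-cong pairs (λ p → cong ⟦_⟧ (does-≟-true (isEdge p))) ⟩
    ∑ pairs (λ p → ⟦ isEdge p ⟧)        ≡⟨ ∑-cartesianProductWith _,_ (allFin m) (allFin m) _ ⟩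
    ∑ (allFin m) (λ i → ∑ (allFin m) (λ j → ⟦ isEdge (i , j) ⟧))
                                        ≡⟨ sum-cartesianProductWith _ (allFin m) (allFin m) ⟨
    edgeCount fromEdges            ∎
    where
    open ≤-Reasoning
    pairs = cartesianProduct (allFin m) (allFin m)
    isEdge : Fin m × Fin m → Bool
    isEdge (i , j) = (toℕ i <ᵇ toℕ j) ∧ adj fromEdges i j
    isEdge? : Decidable (λ p → isEdge p ≡ true)
    isEdge? p = isEdge p Bool.≟ true
    D⊆E : D ⊆ filter isEdge? pairs
    D⊆E {i , j} ij∈D = ∈-filter⁺ isEdge? (∈-cartesianProduct⁺ (∈-allFin i) (∈-allFin j))
      (cong₂ _∧_ (dec-true (toℕ i <? toℕ j) (D< ij∈D)) (cong (_∨ does ((j , i) ∈? D)) (dec-true ((i , j) ∈? D) ij∈D)))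

-- The pair {lo, mid} is taken unordered, since an edge can be traversed either way while a triple
-- is always increasing.
Base : Triple n → Fin n → Fin n → Set
Base s x y = (lo s ≡ x × mid s ≡ y) ⊎ (lo s ≡ y × mid s ≡ x)

-- For p = (x , x′) and q = (y , y′) this is a pair of distinct triples {x , y , z} and {x′ , y′ ,
-- z} with a common apex z.
record Link (T : List (Triple n)) (p q : Fin n × Fin n) : Set where
  field
    s s′     : Triple n
    s∈T      : s ∈ T
    s′∈T     : s′ ∈ T
    distinct : s ≢ s′
    apex     : hi s ≡ hi s′
    base     : Base s (proj₁ p) (proj₁ q)
    base′    : Base s′ (proj₂ p) (proj₂ q)

module LinkGraph (T : List (Triple n)) (T! : Unique T) (T↑ : All Increasing T) (lin : Linear T) where

  Linked : Triple n × Triple n → Set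
  Linked (s , s′) = hi s ≡ hi s′ × s ≢ s′

  linked? : Decidable Linked
  linked? (s , s′) = (hi s Fin.≟ hi s′) ×-dec ¬? (s ≟₃ s′)

  linkedPairs : List (Triple n × Triple n)
  linkedPairs = filter linked? (cartesianProduct T T)

  ends : Triple n × Triple n → Fin (n * n) × Fin (n * n)
  ends (s , s′) = combine (lo s) (lo s′) , combine (mid s) (mid s′)

  linkEdges : List (Fin (n * n) × Fin (n * n))
  linkEdges = map ends linkedPairs

  linkedPairs⁻ : ∀ {s s′} → (s , s′) ∈ linkedPairs → (s ∈ T × s′ ∈ T) × Linked (s , s′)
  linkedPairs⁻ p with ∈-filter⁻ linked? {xs = cartesianProduct T T} p
  ... | p∈ , linked = ∈-cartesianProduct⁻ T T p∈ , linked

  -- `combine` orders pairs lexicographically, and lo s < mid s decides in the first coordinate.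
  linkEdges-< : ∀ {i j} → (i , j) ∈ linkEdges → i Fin.< j
  linkEdges-< ij∈ with ∈-map⁻ ends ij∈
  ... | (s , s′) , p , refl with linkedPairs⁻ p
  ... | (s∈T , _) , _ = Fin.combine-monoˡ-< (lo s′) (mid s′) (proj₁ (All.lookup T↑ s∈T))

  -- This is where linearity enters the edge count: different linked pairs yield different edges.
  lo-mid-injective : ∀ {s t} → s ∈ T → t ∈ T → lo s ≡ lo t → mid s ≡ mid t → s ≡ t
  lo-mid-injective {a , b , _} s∈T t∈T refl refl = lin s∈T t∈T
    (a , b , Fin.<⇒≢ (proj₁ (All.lookup T↑ s∈T)) , (here refl , there (here refl)) , (here refl , there (here refl)))

  linkEdges! : Unique linkEdges
  linkEdges! = unique-map-∈ (Unique.filter⁺ linked? (Unique.cartesianProduct⁺ T! T!)) injective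
    where
    injective : ∀ {p q} → p ∈ linkedPairs → q ∈ linkedPairs → ends p ≡ ends q → p ≡ q
    injective {s , s′} {t , t′} p∈ q∈ eq with linkedPairs⁻ p∈ | linkedPairs⁻ q∈
      | Fin.combine-injective (lo s) (lo s′) (lo t) (lo t′) (cong proj₁ eq)
      | Fin.combine-injective (mid s) (mid s′) (mid t) (mid t′) (cong proj₂ eq)
    ... | (s∈ , s′∈) , _ | (t∈ , t′∈) , _ | lo≡ , lo′≡ | mid≡ , mid′≡ =
      cong₂ _,_ (lo-mid-injective s∈ t∈ lo≡ mid≡) (lo-mid-injective s′∈ t′∈ lo′≡ mid′≡)

  linkGraph : Graph (n * n)
  linkGraph = fromEdges linkEdges linkEdges-<

  linkGraph-adj⁻ : ∀ {i j} → adj linkGraph i j ≡ true → Link T (remQuot n i) (remQuot n j)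
  linkGraph-adj⁻ {i} {j} eq with fromEdges-adj⁻ linkEdges linkEdges-< {i} {j} eq
  ... | inj₁ ij∈ with ∈-map⁻ ends ij∈
  ...   | (s , s′) , p , refl rewrite Fin.remQuot-combine (lo s) (lo s′) | Fin.remQuot-combine (mid s) (mid s′)
    with linkedPairs⁻ p
  ...   | (s∈ , s′∈) , apex , s≢s′ = record { s∈T = s∈ ; s′∈T = s′∈ ; distinct = s≢s′ ; apex = apex
    ; base = inj₁ (refl , refl) ; base′ = inj₁ (refl , refl) }
  linkGraph-adj⁻ {i} {j} eq | inj₂ ji∈ with ∈-map⁻ ends ji∈
  ...   | (s , s′) , p , refl rewrite Fin.remQuot-combine (lo s) (lo s′) | Fin.remQuot-combine (mid s) (mid s′)
    with linkedPairs⁻ p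
  ...   | (s∈ , s′∈) , apex , s≢s′ = record { s∈T = s∈ ; s′∈T = s′∈ ; distinct = s≢s′ ; apex = apex
    ; base = inj₂ (refl , refl) ; base′ = inj₂ (refl , refl) }

  -- The pairs with equal `hi` counted by `collisions` are the linked ones, each giving its own
  -- edge, and the `length T` pairs on the diagonal.
  linkGraph-edgeCount : length T * length T ≤ n * (edgeCount linkGraph + length T)
  linkGraph-edgeCount = ≤-trans (collisions T hi) (*-monoʳ-≤ n (begin
    ∑ T (λ s → ∑ T (λ s′ → ⟦ does (hi s Fin.≟ hi s′) ⟧))
      ≤⟨ ∑-mono T (λ s → ∑-mono T (λ s′ → split s s′)) ⟩
    ∑ T (λ s → ∑ T (λ s′ → ⟦ does (linked? (s , s′)) ⟧ + ⟦ does (s ≟₃ s′) ⟧ * 1))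
      ≡⟨ ∑-cong T (λ s → ∑-distrib-+ T _ _) ⟩
    ∑ T (λ s → ∑ T (λ s′ → ⟦ does (linked? (s , s′)) ⟧) + ∑ T (λ s′ → ⟦ does (s ≟₃ s′) ⟧ * 1))
      ≡⟨ ∑-distrib-+ T _ _ ⟩
    ∑ T (λ s → ∑ T (λ s′ → ⟦ does (linked? (s , s′)) ⟧)) + ∑ T (λ s → ∑ T (λ s′ → ⟦ does (s ≟₃ s′) ⟧ * 1))
      ≤⟨ +-mono-≤ linked≤ (≤-trans (∑-mono T (λ s → ∑-δ-≤ _≟₃_ s (λ _ → 1) T!)) (≤-reflexive (∑-one T))) ⟩
    edgeCount linkGraph + length T ∎))
    where
    open ≤-Reasoning
    split : ∀ s s′ → ⟦ does (hi s Fin.≟ hi s′) ⟧ ≤ ⟦ does (linked? (s , s′)) ⟧ + ⟦ does (s ≟₃ s′) ⟧ * 1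
    split s s′ with does (hi s Fin.≟ hi s′) | does (s ≟₃ s′)
    ... | true  | true  = s≤s z≤n
    ... | true  | false = s≤s z≤n
    ... | false | _     = z≤n
    linked≤ : ∑ T (λ s → ∑ T (λ s′ → ⟦ does (linked? (s , s′)) ⟧)) ≤ edgeCount linkGraph
    linked≤ = begin
      ∑ T (λ s → ∑ T (λ s′ → ⟦ does (linked? (s , s′)) ⟧))
        ≡⟨ ∑-cartesianProductWith _,_ T T (λ p → ⟦ does (linked? p) ⟧) ⟨
      ∑ (cartesianProduct T T) (λ p → ⟦ does (linked? p) ⟧)
        ≡⟨ length-filter-∑ linked? (cartesianProduct T T) ⟨
      length linkedPairs  ≡⟨ length-map ends linkedPairs ⟨
      length linkEdges    ≤⟨ fromEdges-edgeCount linkEdges linkEdges-< linkEdges! ⟩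
      edgeCount linkGraph ∎

-- Degenerate orderings

-- Each edge is charged to its later endpoint under `ord`. `up` and `down` separate the edges on
-- which `ord` agrees with the index order from those on which it reverses it.
edgeCount≤∑earlier : ∀ {k} (H : Graph k) (ord : Fin k → Fin k) → (∀ {u v} → ord u ≡ ord v → u ≡ v) →
  edgeCount H ≤ ∑ (allFin k) (earlierNeighbours H ord)
edgeCount≤∑earlier {k} H ord ord-inj = begin
  edgeCount H
    ≡⟨ sum-cartesianProductWith _ V V ⟩
  ∑ V (λ i → ∑ V (λ j → ⟦ (toℕ i <ᵇ toℕ j) ∧ adj H i j ⟧))
    ≤⟨ ∑-mono V (λ i → ∑-mono V (λ j → split i j)) ⟩
  ∑ V (λ i → ∑ V (λ j → up i j + down j i))
    ≡⟨ ∑∑-distrib-+ up (λ i j → down j i) ⟩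
  ∑ V (λ i → ∑ V (up i)) + ∑ V (λ i → ∑ V (λ j → down j i))
    ≡⟨ cong (∑ V (λ i → ∑ V (up i)) +_) (∑-swap V V (λ i j → down j i)) ⟩
  ∑ V (λ i → ∑ V (up i)) + ∑ V (λ i → ∑ V (down i))
    ≡⟨ ∑∑-distrib-+ up down ⟨
  ∑ V (λ i → ∑ V (λ j → up i j + down i j))
    ≤⟨ ∑-mono V (λ i → ∑-mono V (λ j → merge i j)) ⟩
  ∑ V (λ i → ∑ V (λ j → ⟦ adj H i j ∧ (toℕ (ord i) <ᵇ toℕ (ord j)) ⟧))
    ≡⟨ ∑-swap V V _ ⟩
  ∑ V (earlierNeighbours H ord) ∎
  where
  open ≤-Reasoning
  V = allFin k
  before : Fin k → Fin k → Bool
  before i j = adj H i j ∧ (toℕ (ord i) <ᵇ toℕ (ord j))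
  up down : Fin k → Fin k → ℕ
  up   i j = ⟦ (toℕ i <ᵇ toℕ j) ∧ before i j ⟧
  down i j = ⟦ (toℕ j <ᵇ toℕ i) ∧ before i j ⟧
  ∑∑-distrib-+ : ∀ (f g : Fin k → Fin k → ℕ) →
    ∑ V (λ i → ∑ V (λ j → f i j + g i j)) ≡ ∑ V (λ i → ∑ V (f i)) + ∑ V (λ i → ∑ V (g i))
  ∑∑-distrib-+ f g = trans (∑-cong V (λ i → ∑-distrib-+ V (f i) (g i))) (∑-distrib-+ V _ _)
  merge : ∀ i j → up i j + down i j ≤ ⟦ before i j ⟧
  merge i j with toℕ i <? toℕ j | toℕ j <? toℕ i
  ... | yes i<j | yes j<i = contradiction j<i (<-asym i<j)
  ... | yes i<j | no  j≮i rewrite dec-true (toℕ i <? toℕ j) i<j | dec-false (toℕ j <? toℕ i) j≮i = ≤-reflexive (+-identityʳ _)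
  ... | no  i≮j | yes j<i rewrite dec-false (toℕ i <? toℕ j) i≮j | dec-true (toℕ j <? toℕ i) j<i = ≤-refl
  ... | no  i≮j | no  j≮i rewrite dec-false (toℕ i <? toℕ j) i≮j | dec-false (toℕ j <? toℕ i) j≮i = z≤n
  split : ∀ i j → ⟦ (toℕ i <ᵇ toℕ j) ∧ adj H i j ⟧ ≤ up i j + down j i
  split i j rewrite symm H j i with toℕ i <? toℕ j
  ... | no  i≮j rewrite dec-false (toℕ i <? toℕ j) i≮j = z≤n
  ... | yes i<j rewrite dec-true (toℕ i <? toℕ j) i<j with adj H i j
  ...   | false = z≤n
  ...   | true with <-cmp (toℕ (ord i)) (toℕ (ord j))
  ...     | tri< o< _ _ rewrite dec-true (toℕ (ord i) <? toℕ (ord j)) o< = s≤s z≤n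
  ...     | tri≈ _ o≡ _ = contradiction (cong toℕ (ord-inj (Fin.toℕ-injective o≡))) (<⇒≢ i<j)
  ...     | tri> _ _ o> rewrite dec-true (toℕ (ord j) <? toℕ (ord i)) o> = m≤n+m 1 _

-- The deficits add up to 2k minus the sum of all back degrees, hence to at most 2k minus the number
-- of edges, which is t.
∑deficit≤ : ∀ {k t} {H : Graph k} → ℤ.+ edgeCount H ≡ ℤ.+ (2 * k) ℤ.- t → (D : TwoDegenerate H) →
  ∑ (allFin k) (λ v → 2 ∸ earlierNeighbours H (proj₁ D) v) ≤ ℤ.∣ t ∣
∑deficit≤ {k} {t} {H} eq (ord , ord-inj , back≤2) = +-cancelˡ-≤ (∑ V back) _ _ (begin
  ∑ V back + ∑ V (λ v → 2 ∸ back v)     ≡⟨ ∑-distrib-+ V back _ ⟨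
  ∑ V (λ v → back v + (2 ∸ back v))     ≡⟨ ∑-cong V (λ v → m+[n∸m]≡n (back≤2 v)) ⟩
  ∑ V (λ _ → 2)                         ≡⟨ ∑-const V 2 ⟩
  length V * 2                          ≡⟨ cong (_* 2) (length-tabulate {n = k} id) ⟩
  k * 2                                 ≡⟨ *-comm k 2 ⟩
  2 * k                                 ≡⟨ cong ℤ.∣_∣ 2k≡ ⟩
  ℤ.∣ ℤ.+ edgeCount H ℤ.+ t ∣             ≤⟨ ℤ.∣i+j∣≤∣i∣+∣j∣ (ℤ.+ edgeCount H) t ⟩
  edgeCount H + ℤ.∣ t ∣                 ≤⟨ +-monoˡ-≤ ℤ.∣ t ∣ (edgeCount≤∑earlier H ord ord-inj) ⟩
  ∑ V back + ℤ.∣ t ∣                    ∎)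
  where
  open ≤-Reasoning
  V = allFin k
  back = earlierNeighbours H ord
  2k≡ : ℤ.+ (2 * k) ≡ ℤ.+ edgeCount H ℤ.+ t
  2k≡ = sym (trans (cong (ℤ._+ t) eq) (trans (ℤ.+-assoc (ℤ.+ (2 * k)) (ℤ.- t) t)
    (trans (cong (ℤ._+_ (ℤ.+ (2 * k))) (ℤ.+-inverseˡ t)) (ℤ.+-identityʳ _))))

-- Growing a configuration along a degenerate ordering

infix 4 _∈²_
_∈²_ : Fin n × Fin n → List (Fin n) → Set
p ∈² W = proj₁ p ∈ W × proj₂ p ∈ W

module Growing (T : List (Triple n)) (T↑ : All Increasing T) (lin : Linear T) where

  open Link
  private
    module V = Insert (Fin._≟_ {n})
    module E = Insert (_≟₃_ {n})
  open import Data.List.Membership.DecPropositional (Fin._≟_ {n}) using (_∈?_)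

  base-⊑ : ∀ {W} {s : Triple n} {x y} → Base s x y → x ∈ W → y ∈ W → hi s ∈ W → s ⊑ W
  base-⊑ (inj₁ (refl , refl)) x∈ y∈ z∈ = x∈ ∷ y∈ ∷ z∈ ∷ []
  base-⊑ (inj₂ (refl , refl)) x∈ y∈ z∈ = y∈ ∷ x∈ ∷ z∈ ∷ []

  base-∈ : ∀ {s : Triple n} {x y} → Base s x y → x ∈ vertices s
  base-∈ (inj₁ (refl , _)) = here refl
  base-∈ (inj₂ (_ , refl)) = there (here refl)

  base-<hi : ∀ {s x y} → s ∈ T → Base s x y → x Fin.< hi s
  base-<hi s∈T (inj₁ (refl , _)) = <-trans (proj₁ (All.lookup T↑ s∈T)) (proj₂ (All.lookup T↑ s∈T))
  base-<hi s∈T (inj₂ (_ , refl)) = proj₂ (All.lookup T↑ s∈T)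

  -- Both triples contain `x` and the common apex, two distinct vertices, so linearity makes them
  -- equal.
  base-functional : ∀ {s t x y y′} → s ∈ T → t ∈ T → hi s ≡ hi t → Base s x y → Base t x y′ → y ≡ y′
  base-functional {s} {t} {x} s∈T t∈T hi≡ b b′
    with lin s∈T t∈T (x , hi s , Fin.<⇒≢ (base-<hi s∈T b) ,
      (base-∈ b , there (there (here refl))) , (base-∈ b′ , there (there (here hi≡))))
  base-functional s∈T _ _ (inj₁ (refl , refl)) (inj₁ (refl , refl)) | refl = refl
  base-functional s∈T _ _ (inj₁ (refl , refl)) (inj₂ (refl , eq))   | refl = eq
  base-functional s∈T _ _ (inj₂ (refl , refl)) (inj₁ (eq , refl))   | refl = eq
  base-functional s∈T _ _ (inj₂ (refl , refl)) (inj₂ (refl , refl)) | refl = refl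

  -- A common apex would determine both coordinates of the neighbour. Hence links from `p` to
  -- different neighbours have no triple in common.
  apex-distinct : ∀ {p q q′} (ℓ : Link T p q) (ℓ′ : Link T p q′) → q ≢ q′ → hi (s ℓ′) ≢ hi (s ℓ)
  apex-distinct ℓ ℓ′ q≢q′ hi≡ = q≢q′ (cong₂ _,_
    (base-functional (s∈T ℓ) (s∈T ℓ′) (sym hi≡) (base ℓ) (base ℓ′))
    (base-functional (s′∈T ℓ) (s′∈T ℓ′) (trans (sym (apex ℓ)) (trans (sym hi≡) (apex ℓ′))) (base′ ℓ) (base′ ℓ′)))

  -- γ is the surplus of new triples over new vertices guaranteed by adding the link.
  data Fresh (F : List (Triple n)) {p q} (ℓ : Link T p q) : ℕ → Set where
    none : Fresh F ℓ 0
    one  : s ℓ ∉ F ⊎ s′ ℓ ∉ F → Fresh F ℓ 1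

  module _ {p q} (ℓ : Link T p q) where

    addApex : List (Fin n) → List (Fin n)
    addApex = V.insert (hi (s ℓ))

    addTriples : List (Triple n) → List (Triple n)
    addTriples F = E.insert (s ℓ) (E.insert (s′ ℓ) F)

    addLink : ∀ {W F} → Subconfiguration T W F → p ∈² W → q ∈² W →
      Subconfiguration T (addApex W) (addTriples F)
    addLink {W} {F} C (x∈ , x′∈) (y∈ , y′∈) = record
      { unique!  = E.insert-Unique (s ℓ) _ (E.insert-Unique (s′ ℓ) F (unique! C))
      ; included = E.insert-All (s ℓ) _ (s∈T ℓ) (E.insert-All (s′ ℓ) F (s′∈T ℓ) (included C))
      ; covered  = E.insert-All (s ℓ) _ (base-⊑ (base ℓ) (old x∈) (old y∈) z∈)
          (E.insert-All (s′ ℓ) F (base-⊑ (base′ ℓ) (old x′∈) (old y′∈) (subst (_∈ addApex W) (apex ℓ) z∈))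
            (All.map (⊑-⊆ old) (covered C)))
      }
      where
      old : W ⊆ addApex W
      old = V.⊆-insert (hi (s ℓ)) W
      z∈ : hi (s ℓ) ∈ addApex W
      z∈ = V.∈-insert (hi (s ℓ)) W

    s∉insert-s′ : ∀ {F} → s ℓ ∉ F → s ℓ ∉ E.insert (s′ ℓ) F
    s∉insert-s′ {F} s∉F s∈ with E.∈-insert⁻ (s′ ℓ) F s∈
    ... | inj₁ s≡s′ = distinct ℓ s≡s′
    ... | inj₂ s∈F  = s∉F s∈F

    length-addTriples-≤ : ∀ F → length (addTriples F) ≤ 2 + length F
    length-addTriples-≤ F = ≤-trans (E.length-insert-≤ (s ℓ) (E.insert (s′ ℓ) F)) (s≤s (E.length-insert-≤ (s′ ℓ) F))

    length-addTriples-≥ : ∀ F → length F ≤ length (addTriples F)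
    length-addTriples-≥ F = ≤-trans (E.length-insert-≥ (s′ ℓ) F) (E.length-insert-≥ (s ℓ) (E.insert (s′ ℓ) F))

    length-addTriples-> : ∀ F → s ℓ ∉ F ⊎ s′ ℓ ∉ F → suc (length F) ≤ length (addTriples F)
    length-addTriples-> F (inj₁ s∉F) = ≤-trans (s≤s (E.length-insert-≥ (s′ ℓ) F))
      (≤-reflexive (sym (E.length-insert-∉ (s∉insert-s′ s∉F))))
    length-addTriples-> F (inj₂ s′∉F) = ≤-trans (≤-reflexive (sym (E.length-insert-∉ s′∉F)))
      (E.length-insert-≥ (s ℓ) (E.insert (s′ ℓ) F))

    length-addTriples-both : ∀ F → s ℓ ∉ F → s′ ℓ ∉ F → length (addTriples F) ≡ 2 + length F
    length-addTriples-both F s∉F s′∉F =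
      trans (E.length-insert-∉ (s∉insert-s′ s∉F)) (cong suc (E.length-insert-∉ s′∉F))

    -- A new apex pays for itself, because then both triples are new.
    addLink-gain : ∀ {W F γ} → Subconfiguration T W F → Fresh F ℓ γ →
      γ + (length (addApex W) + length F) ≤ length (addTriples F) + length W
    addLink-gain {W} {F} {γ} C fresh with hi (s ℓ) ∈? W
    addLink-gain {W} {F} {γ} C fresh | no z∉W rewrite length-addTriples-both F
          (λ s∈F → z∉W (All.lookup (All.lookup (covered C) s∈F) (there (there (here refl)))))
          (λ s′∈F → z∉W (All.lookup (All.lookup (covered C) s′∈F) (there (there (here (apex ℓ)))))) =
      ≤-trans (+-monoˡ-≤ _ (γ≤1 fresh)) (≤-reflexive (cong (2 +_) (+-comm (length W) (length F))))
      where
      γ≤1 : ∀ {γ} → Fresh F ℓ γ → γ ≤ 1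
      γ≤1 none    = z≤n
      γ≤1 (one _) = s≤s z≤n
    addLink-gain {W} {F} C none | yes z∈W =
      ≤-trans (≤-reflexive (+-comm (length W) (length F))) (+-monoˡ-≤ (length W) (length-addTriples-≥ F))
    addLink-gain {W} {F} C (one new) | yes z∈W =
      ≤-trans (≤-reflexive (cong suc (+-comm (length W) (length F)))) (+-monoˡ-≤ (length W) (length-addTriples-> F new))

    -- Every triple just added has an apex other than that of `ℓ′`, so it cannot be a triple of
    -- `ℓ′`.
    fresh-addTriples : ∀ {F q′ γ} (ℓ′ : Link T p q′) → q ≢ q′ → Fresh F ℓ′ γ → Fresh (addTriples F) ℓ′ γ
    fresh-addTriples ℓ′ q≢q′ none = none
    fresh-addTriples {F} ℓ′ q≢q′ (one new) = one (stillNew new)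
      where
      hi≢ = apex-distinct ℓ ℓ′ q≢q′
      avoid : ∀ {t} → hi t ≡ hi (s ℓ′) → t ∉ F → t ∉ addTriples F
      avoid hi≡ t∉F t∈ with E.∈-insert⁻ (s ℓ) _ t∈
      ... | inj₁ refl = hi≢ (sym hi≡)
      ... | inj₂ t∈′ with E.∈-insert⁻ (s′ ℓ) F t∈′
      ...   | inj₁ refl = hi≢ (trans (sym hi≡) (sym (apex ℓ)))
      ...   | inj₂ t∈F  = t∉F t∈F
      stillNew : s ℓ′ ∉ F ⊎ s′ ℓ′ ∉ F → s ℓ′ ∉ addTriples F ⊎ s′ ℓ′ ∉ addTriples F
      stillNew (inj₁ s∉F)  = inj₁ (avoid refl s∉F)
      stillNew (inj₂ s′∉F) = inj₂ (avoid (sym (apex ℓ′)) s′∉F)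

  -- `gain` says without subtraction that the new triples exceed the new vertices by at least b · γ.
  record Growth (W : List (Fin n)) (F : List (Triple n)) (γ b : ℕ) : Set where
    field
      W′     : List (Fin n)
      F′     : List (Triple n)
      config : Subconfiguration T W′ F′
      W⊆W′   : W ⊆ W′
      gain   : b * γ + (length W′ + length F) ≤ length F′ + length W
      small  : length F′ ≤ b * 2 + length F

  grow : ∀ {p W F γ} Q → Subconfiguration T W F → p ∈² W → Unique Q → All (_∈² W) Q →
    All (λ q → Σ (Link T p q) λ ℓ → Fresh F ℓ γ) Q → Growth W F γ (length Q)
  grow {W = W} {F} [] C p∈ [] [] [] = record
    { config = C ; W⊆W′ = id ; gain = ≤-reflexive (+-comm (length W) (length F)) ; small = ≤-refl }
  grow {W = W} {F} {γ} (q ∷ Q) C p∈ (q∉Q ∷ Q!) (q∈ ∷ Q∈) ((ℓ , fresh) ∷ ℓs) = record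
    { config = config ; W⊆W′ = W⊆W′ ∘ old ; gain = total ; small = small′ }
    where
    W₁ = addApex ℓ W
    F₁ = addTriples ℓ F
    old : W ⊆ W₁
    old = V.⊆-insert (hi (s ℓ)) W
    lift² : ∀ {q} → q ∈² W → q ∈² W₁
    lift² (y∈ , y′∈) = old y∈ , old y′∈
    rest : Growth W₁ F₁ γ (length Q)
    rest = grow Q (addLink ℓ C p∈ q∈) (lift² p∈) Q! (All.map lift² Q∈)
      (All.zipWith (λ { (q≢q′ , ℓ′ , fr) → ℓ′ , fresh-addTriples ℓ ℓ′ q≢q′ fr }) (q∉Q , ℓs))
    open Growth rest
    small′ : length F′ ≤ 2 + length Q * 2 + length F
    small′ = ≤-trans small (≤-trans (+-monoʳ-≤ (length Q * 2) (length-addTriples-≤ ℓ F))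
      (≤-reflexive (shift (length Q * 2) (length F))))
      where
      shift : ∀ a b → a + (2 + b) ≡ 2 + a + b
      shift = solve-∀
    total : γ + length Q * γ + (length W′ + length F) ≤ length F′ + length W
    -- The intermediate sizes are added to both sides, so that the gain of the first link and that
    -- of the rest can simply be summed.
    total = +-cancelʳ-≤ (length W₁ + length F₁) _ _ (begin
      γ + length Q * γ + (length W′ + length F) + (length W₁ + length F₁)
        ≡⟨ regroup γ (length Q * γ) (length W′) (length F) (length W₁) (length F₁) ⟩
      (length Q * γ + (length W′ + length F₁)) + (γ + (length W₁ + length F))
        ≤⟨ +-mono-≤ gain (addLink-gain ℓ C fresh) ⟩
      (length F′ + length W₁) + (length F₁ + length W)
        ≡⟨ regroup′ (length F′) (length W₁) (length F₁) (length W) ⟩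
      length F′ + length W + (length W₁ + length F₁) ∎)
      where
      open ≤-Reasoning
      regroup : ∀ g h a b c d → g + h + (a + b) + (c + d) ≡ (h + (a + d)) + (g + (c + b))
      regroup = solve-∀
      regroup′ : ∀ a b c d → (a + b) + (c + d) ≡ a + d + (b + c)
      regroup′ = solve-∀

  -- By `gain`, vertices outgrow triples by at most the deficit 2 ∸ b. The 4 in `small` stands for
  -- two links of two triples each.
  record Extension (W : List (Fin n)) (F : List (Triple n)) (p : Fin n × Fin n) (b : ℕ) : Set where
    field
      W′     : List (Fin n)
      F′     : List (Triple n)
      config : Subconfiguration T W′ F′
      W⊆W′   : W ⊆ W′
      p∈     : p ∈² W′
      gain   : length W′ + length F ≤ length F′ + length W + (2 ∸ b)
      small  : length F′ ≤ 4 + length F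

  -- If x or x′ is new, each earlier neighbour contributes a surplus of one triple,
  -- since a triple through a new vertex is new; otherwise no vertex is spent on the pair.
  extend : ∀ {W F} p Q → Subconfiguration T W F → Unique Q → All (_∈² W) Q → All (Link T p) Q →
    length Q ≤ 2 → Extension W F p (length Q)
  extend {W} {F} p@(x , x′) Q C Q! Q∈ ℓs Q≤2 with (x ∈? W) ×-dec (x′ ∈? W)
  ... | yes p∈W = record { config = config ; W⊆W′ = W⊆W′ ; p∈ = W⊆W′ (proj₁ p∈W) , W⊆W′ (proj₂ p∈W)
    ; gain  = ≤-trans (subst (λ z → z + (length W′ + length F) ≤ length F′ + length W) (*-zeroʳ (length Q)) gain) (m≤m+n (length F′ + length W) _)
    ; small = ≤-trans small (+-monoˡ-≤ (length F) (*-monoˡ-≤ 2 Q≤2)) }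
    where
    growth : Growth W F 0 (length Q)
    growth = grow Q C p∈W Q! Q∈ (All.map (λ ℓ → ℓ , none) ℓs)
    open Growth growth
  ... | no p∉W = record { config = config ; W⊆W′ = W⊆W′ ∘ old ; p∈ = W⊆W′ (proj₁ p∈W₀) , W⊆W′ (proj₂ p∈W₀)
    ; gain  = gain′
    ; small = ≤-trans small (+-monoˡ-≤ (length F) (*-monoˡ-≤ 2 Q≤2)) }
    where
    W₀ = V.insert x (V.insert x′ W)
    old : W ⊆ W₀
    old = V.⊆-insert x (V.insert x′ W) ∘ V.⊆-insert x′ W
    p∈W₀ : p ∈² W₀
    p∈W₀ = V.∈-insert x (V.insert x′ W) , V.⊆-insert x (V.insert x′ W) (V.∈-insert x′ W)
    ∣W₀∣≤ : length W₀ ≤ 2 + length W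
    ∣W₀∣≤ = ≤-trans (V.length-insert-≤ x (V.insert x′ W)) (s≤s (V.length-insert-≤ x′ W))
    -- If `x` is missing from `W`, the triple through `x` is new; otherwise `x′` is missing and the
    -- triple through `x′` is new.
    new : ∀ {q} (ℓ : Link T p q) → s ℓ ∉ F ⊎ s′ ℓ ∉ F
    new ℓ with x ∈? W
    ... | no  x∉W = inj₁ λ s∈F → x∉W (All.lookup (All.lookup (covered C) s∈F) (base-∈ (base ℓ)))
    ... | yes x∈W = inj₂ λ s′∈F → p∉W (x∈W , All.lookup (All.lookup (covered C) s′∈F) (base-∈ (base′ ℓ)))
    growth : Growth W₀ F 1 (length Q)
    growth = grow Q (record { unique! = unique! C ; included = included C ; covered = All.map (⊑-⊆ old) (covered C) })
      p∈W₀ Q! (All.map (λ (y∈ , y′∈) → old y∈ , old y′∈) Q∈) (All.map (λ ℓ → ℓ , one (new ℓ)) ℓs)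
    open Growth growth
    gain′ : length W′ + length F ≤ length F′ + length W + (2 ∸ length Q)
    -- The pair costs at most two vertices; the surplus refunds `length Q` of them and the rest is
    -- the deficit.
    gain′ = +-cancelˡ-≤ (length Q) _ _ (begin
      length Q + (length W′ + length F)                ≡⟨ cong (_+ (length W′ + length F)) (*-identityʳ (length Q)) ⟨
      length Q * 1 + (length W′ + length F)            ≤⟨ gain ⟩
      length F′ + length W₀                            ≤⟨ +-monoʳ-≤ (length F′) ∣W₀∣≤ ⟩
      length F′ + (2 + length W)                       ≡⟨ cong (λ z → length F′ + (z + length W)) (m+[n∸m]≡n Q≤2) ⟨
      length F′ + (length Q + (2 ∸ length Q) + length W) ≡⟨ regroup (length F′) (length Q) (2 ∸ length Q) (length W) ⟩
      length Q + (length F′ + length W + (2 ∸ length Q)) ∎)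
      where
      open ≤-Reasoning
      regroup : ∀ f q r w → f + (q + r + w) ≡ q + (f + w + r)
      regroup = solve-∀

  -- Running through the whole ordering

  module _ {k : ℕ} (H : Graph k) (ord : Fin k → Fin k) (ord-inj : ∀ {u v} → ord u ≡ ord v → u ≡ v)
    (back≤2 : ∀ v → earlierNeighbours H ord v ≤ 2)
    (g : Fin k → Fin n × Fin n) (g-inj : ∀ {u v} → g u ≡ g v → u ≡ v)
    (link : ∀ {u v} → adj H u v ≡ true → Link T (g v) (g u))
    (τ : ℕ) (deficit≤τ : ∑ (allFin k) (λ v → 2 ∸ earlierNeighbours H ord v) ≤ τ) (e : ℕ) where

    deficit : Fin k → ℕ
    deficit v = 2 ∸ earlierNeighbours H ord v

    -- The state once the vertices at positions below `j` are placed; `bound` charges the excess of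
    -- vertices over triples to their deficits.
    record Stage (j : ℕ) : Set where
      field
        P         : List (Fin k)
        P!        : Unique P
        P<j       : ∀ {v} → v ∈ P → toℕ (ord v) < j
        <j⇒∈P     : ∀ {v} → toℕ (ord v) < j → v ∈ P
        W         : List (Fin n)
        F         : List (Triple n)
        config    : Subconfiguration T W F
        processed : All (λ v → g v ∈² W) P
        bound     : length W ≤ length F + ∑ P deficit
        short     : length F < e

    deficit-≤ : ∀ {P} → Unique P → ∑ P deficit ≤ τ
    deficit-≤ P! = ≤-trans (∑-⊆ deficit P! (λ {v} _ → ∈-allFin v)) deficit≤τ

    -- The earlier neighbours of `v` sit at positions below `j`, so their pairs are already in `W`
    -- and `extend` applies.
    process : ∀ {j} v → toℕ (ord v) ≡ j → Stage j → Configuration T (e + (τ + 3)) e ⊎ Stage (suc j)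
    process {j} v v≡j st = result
      where
      open Stage st
      isEarlier? : Decidable (λ u → adj H u v ∧ (toℕ (ord u) <ᵇ toℕ (ord v)) ≡ true)
      isEarlier? u = (adj H u v ∧ (toℕ (ord u) <ᵇ toℕ (ord v))) Bool.≟ true
      earlier = filter isEarlier? (allFin k)
      ∣earlier∣ : length (map g earlier) ≡ earlierNeighbours H ord v
      ∣earlier∣ = trans (length-map g earlier) (trans (length-filter-∑ isEarlier? (allFin k))
        (∑-cong (allFin k) (λ u → cong ⟦_⟧ (does-≟-true _))))
      earlier⁻ : ∀ {u} → u ∈ earlier → adj H u v ≡ true × u ∈ P
      earlier⁻ {u} u∈ with adj H u v | toℕ (ord u) <? toℕ (ord v) | proj₂ (∈-filter⁻ isEarlier? {xs = allFin k} u∈)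
      ... | true | yes u<v | _  = refl , <j⇒∈P (subst (toℕ (ord u) <_) v≡j u<v)
      ... | true | no  u≮v | eq = contradiction (<ᵇ⇒< _ _ (Equivalence.from T-≡ eq)) u≮v
      extension : Extension W F (g v) (length (map g earlier))
      extension = extend (g v) (map g earlier) config
        (Unique.map⁺ g-inj (Unique.filter⁺ isEarlier? (Unique.allFin⁺ k)))
        (All.map⁺ (All.tabulate λ u∈ → All.lookup processed (proj₂ (earlier⁻ u∈))))
        (All.map⁺ (All.tabulate λ u∈ → link (proj₁ (earlier⁻ u∈))))
        (≤-trans (≤-reflexive ∣earlier∣) (back≤2 v))
      open Extension extension renaming (config to config′)
      v∷P! : Unique (v ∷ P)
      v∷P! = All.tabulate (λ { u∈P refl → <-irrefl v≡j (P<j u∈P) }) ∷ P!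
      bound′ : length W′ ≤ length F′ + ∑ (v ∷ P) deficit
      bound′ = +-cancelʳ-≤ (length F) _ _ (begin
        length W′ + length F                                  ≤⟨ gain ⟩
        length F′ + length W + (2 ∸ length (map g earlier))   ≡⟨ cong (λ b → length F′ + length W + (2 ∸ b)) ∣earlier∣ ⟩
        length F′ + length W + deficit v                      ≤⟨ +-monoˡ-≤ (deficit v) (+-monoʳ-≤ (length F′) bound) ⟩
        length F′ + (length F + ∑ P deficit) + deficit v      ≡⟨ regroup (length F′) (length F) (∑ P deficit) (deficit v) ⟩
        length F′ + (deficit v + ∑ P deficit) + length F      ∎)
        where
        open ≤-Reasoning
        regroup : ∀ a b c d → a + (b + c) + d ≡ a + (d + c) + b
        regroup = solve-∀
      result : Configuration T (e + (τ + 3)) e ⊎ Stage (suc j)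
      result with e ≤? length F′
      -- Before this step there were at most e - 1 triples and at most four were added, so the
      -- target is overshot by at most 3.
      ... | yes e≤F′ = inj₁ (W′ , F′ , config′ , e≤F′ , (begin
        length W′                       ≤⟨ bound′ ⟩
        length F′ + ∑ (v ∷ P) deficit   ≤⟨ +-mono-≤ small (deficit-≤ v∷P!) ⟩
        3 + suc (length F) + τ          ≤⟨ +-monoˡ-≤ τ (+-monoʳ-≤ 3 short) ⟩
        3 + e + τ                       ≡⟨ regroup e τ ⟩
        e + (τ + 3)                     ∎))
        where
        open ≤-Reasoning
        regroup : ∀ a b → 3 + a + b ≡ a + (b + 3)
        regroup = solve-∀
      ... | no e≰F′ = inj₂ record
        { P         = v ∷ P
        ; P!        = v∷P!
        ; P<j       = λ { (here refl) → s≤s (≤-reflexive v≡j) ; (there u∈P) → m<n⇒m<1+n (P<j u∈P) }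
        ; <j⇒∈P     = λ {u} u<1+j → insertion (m≤n⇒m<n∨m≡n (≤-pred u<1+j))
        ; config    = config′
        ; processed = p∈ ∷ All.map (λ (y∈ , y′∈) → W⊆W′ y∈ , W⊆W′ y′∈) processed
        ; bound     = bound′
        ; short     = ≰⇒> e≰F′
        }
        where
        insertion : ∀ {u} → toℕ (ord u) < j ⊎ toℕ (ord u) ≡ j → u ∈ v ∷ P
        insertion (inj₁ u<j) = there (<j⇒∈P u<j)
        insertion (inj₂ u≡j) = here (ord-inj (Fin.toℕ-injective (trans u≡j (sym v≡j))))

    stage : 1 ≤ e → ∀ j → Configuration T (e + (τ + 3)) e ⊎ Stage j
    stage 1≤e zero = inj₂ record
      { P = [] ; P! = [] ; P<j = λ () ; <j⇒∈P = λ () ; W = [] ; F = []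
      ; config = record { unique! = [] ; included = [] ; covered = [] }
      ; processed = [] ; bound = z≤n ; short = 1≤e }
    stage 1≤e (suc j) with stage 1≤e j
    ... | inj₁ found = inj₁ found
    ... | inj₂ st with Fin.any? (λ v → toℕ (ord v) ≟ j)
    ...   | yes (v , v≡j) = process v v≡j st
    -- Position `j` is vacant, so the same data serve for the next stage.
    ...   | no  none≡j    = inj₂ record
      { P = P ; P! = P! ; P<j = m<n⇒m<1+n ∘ P<j
      ; <j⇒∈P = λ {u} u<1+j → <j⇒∈P (≤∧≢⇒< (≤-pred u<1+j) (λ u≡j → none≡j (u , u≡j)))
      ; W = W ; F = F ; config = config ; processed = processed ; bound = bound ; short = short }
      where open Stage st

    -- If fewer than e triples were ever collected, the k distinct pairs would fit in W × W.
    copy⇒configuration : 1 ≤ e → (e + τ) * (e + τ) < k → Configuration T (e + (τ + 3)) e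
    copy⇒configuration 1≤e large with stage 1≤e k
    ... | inj₁ found = found
    ... | inj₂ st = contradiction large (≤⇒≯ (begin
      k                               ≡⟨ length-tabulate {n = k} id ⟨
      length (allFin k)               ≡⟨ length-map g (allFin k) ⟨
      length (map g (allFin k))       ≤⟨ length-⊆ (Unique.map⁺ g-inj (Unique.allFin⁺ k)) pairs⊆ ⟩
      length (cartesianProduct W W)   ≡⟨ length-cartesianProduct W W ⟩
      length W * length W             ≤⟨ *-mono-≤ W≤ W≤ ⟩
      (e + τ) * (e + τ)               ∎))
      where
      open ≤-Reasoning
      open Stage st
      W≤ : length W ≤ e + τ
      W≤ = ≤-trans bound (+-mono-≤ (<⇒≤ short) (deficit-≤ P!))
      pairs⊆ : map g (allFin k) ⊆ cartesianProduct W W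
      pairs⊆ gv∈ with v , _ , refl ← ∈-map⁻ g gv∈ with x∈ , x′∈ ← All.lookup processed (<j⇒∈P (Fin.toℕ<n (ord v))) =
        ∈-cartesianProduct⁺ x∈ x′∈

-- Density of the graph of pairs and conclusion

configuration-⊆ : ∀ {S T : List (Triple n)} {v e} → S ⊆ T → Configuration S v e → Configuration T v e
configuration-⊆ S⊆T (W , F , C , e≤F , W≤v) = W , F , record
  { unique! = unique! C ; included = All.map S⊆T (included C) ; covered = covered C } , e≤F , W≤v

configuration-mono : ∀ {T : List (Triple n)} {v v′ e} → v ≤ v′ → Configuration T v e → Configuration T v′ e
configuration-mono v≤v′ (W , F , C , e≤F , W≤v) = W , F , C , e≤F , ≤-trans W≤v v≤v′

-- For n ≥ 2q the subtracted m in E ≥ m²/n − m is at most half of m²/n.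
link-density : ∀ n p q m E → 1 ≤ n → 1 ≤ p → 2 * q ≤ n → p * n ^ 2 ≤ q * m → m * m ≤ n * (E + m) →
  (p * p) ^ 2 * (n * n) ^ 3 ≤ (2 * (q * q)) ^ 2 * E ^ 2
link-density n@(suc _) p q m E _ 1≤p 2q≤n dense edges≥ = begin
  (p * p) ^ 2 * (n * n) ^ 3       ≡⟨ square-left p n ⟩
  -- Both sides are squares, so comparing p² n³ with 2 q² E is enough.
  (p * p * n ^ 3) * (p * p * n ^ 3) ≤⟨ *-mono-≤ linear linear ⟩
  (2 * (q * q) * E) * (2 * (q * q) * E) ≡⟨ square-right (2 * (q * q)) E ⟩
  (2 * (q * q)) ^ 2 * E ^ 2       ∎
  where
  open ≤-Reasoning
  -- The powers are unfolded by hand because solve-∀ fails on _^_.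
  square-left : ∀ p n → p * p * (p * p * 1) * (n * n * (n * n * (n * n * 1))) ≡ (p * p * (n * (n * (n * 1)))) * (p * p * (n * (n * (n * 1))))
  square-left = solve-∀
  square-right : ∀ r E → (r * E) * (r * E) ≡ r * (r * 1) * (E * (E * 1))
  square-right = solve-∀
  2qn≤qm : 2 * q * n ≤ q * m
  2qn≤qm = begin
    2 * q * n ≤⟨ *-monoˡ-≤ n 2q≤n ⟩
    n * n     ≡⟨ one-times n ⟩
    1 * n ^ 2 ≤⟨ *-monoˡ-≤ (n ^ 2) 1≤p ⟩
    p * n ^ 2 ≤⟨ dense ⟩
    q * m     ∎
    where
    one-times : ∀ n → n * n ≡ 1 * (n * (n * 1))
    one-times = solve-∀
  -- Of two copies of (q m)² one absorbs the term coming from the subtracted m.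
  [qm]²≤ : (q * m) * (q * m) ≤ 2 * (q * q) * E * n
  [qm]²≤ = +-cancelʳ-≤ ((q * m) * (q * m)) _ _ (begin
    (q * m) * (q * m) + (q * m) * (q * m)       ≡⟨ double q m ⟩
    2 * (q * q) * (m * m)                       ≤⟨ *-monoʳ-≤ (2 * (q * q)) edges≥ ⟩
    2 * (q * q) * (n * (E + m))                 ≡⟨ expand q m n E ⟩
    2 * (q * q) * E * n + (q * m) * (2 * q * n) ≤⟨ +-monoʳ-≤ (2 * (q * q) * E * n) (*-monoʳ-≤ (q * m) 2qn≤qm) ⟩
    2 * (q * q) * E * n + (q * m) * (q * m)     ∎)
    where
    double : ∀ q m → (q * m) * (q * m) + (q * m) * (q * m) ≡ 2 * (q * q) * (m * m)
    double = solve-∀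
    expand : ∀ q m n E → 2 * (q * q) * (n * (E + m)) ≡ 2 * (q * q) * E * n + (q * m) * (2 * q * n)
    expand = solve-∀
  linear : p * p * n ^ 3 ≤ 2 * (q * q) * E
  linear = *-cancelʳ-≤ _ _ n (begin
    p * p * n ^ 3 * n         ≡⟨ factor p n ⟩
    (p * n ^ 2) * (p * n ^ 2) ≤⟨ *-mono-≤ dense dense ⟩
    (q * m) * (q * m)         ≤⟨ [qm]²≤ ⟩
    2 * (q * q) * E * n       ∎)
    where
    factor : ∀ p n → p * p * (n * (n * (n * 1))) * n ≡ (p * (n * (n * 1))) * (p * (n * (n * 1)))
    factor = solve-∀

theorem1p4 : StatementA → StatementB
-- In d = |t| + 3 the first summand bounds the total deficit and the second the overshoot; the star
-- case needs only 3.
theorem1p4 (t , k₀ , A) = τ + 3 , λ e 1≤e p q 1≤p 1≤q →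
  -- Large enough for (A), and more than the number of pairs from e + τ vertices.
  let k          = k₀ + suc ((e + τ) * (e + τ))
      -- The core has at least (p / (q e)) n² triples, which `link-density` turns into the constant
      -- p² / (2 (q e)²) for the graph.
      (n₀ , G⊇H) = A k (m≤m+n k₀ _) (p * p) (2 * ((q * e) * (q * e))) (*-mono-≤ 1≤p 1≤p)
        (*-mono-≤ {1} {2} (s≤s z≤n) (*-mono-≤ (*-mono-≤ 1≤q 1≤e) (*-mono-≤ 1≤q 1≤e)))
  -- The summands give n² ≥ n₀ for (A) and n ≥ 2 q e for `link-density`; `suc` keeps n positive.
  in suc (n₀ + 2 * (q * e)) , λ n N≤n 𝓗 dense →
  let (T , T↑ , E≡T) = triples (edges 𝓗) (uniform 𝓗)
      T!             = Unique.map⁻ (subst Unique E≡T (unique 𝓗))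
      L              = linearCore T T↑
  in configuration⇒hasConfig 𝓗 E≡T (case star-or-large-core e T! L of λ
    { (inj₁ star)  → configuration-mono (+-monoʳ-≤ e (m≤n+m 3 τ)) star
    ; (inj₂ large) →
      let open LinearCore L
          core↑   = All.tabulate (All.lookup T↑ ∘ core⊆)
          open LinkGraph core core! core↑ linear
          1≤n     = ≤-trans (s≤s z≤n) N≤n
          dense′  = ≤-trans dense (≤-trans (*-monoʳ-≤ q (≤-trans (≤-reflexive (trans (cong length E≡T) (length-map toSet T))) large))
                      (≤-reflexive (rearrange q (length core) e)))
          (H , ((ord , ord-inj , back≤2) , ∣H∣≡) , f , f-inj , f-hom) = G⊇H (n * n)
            (≤-trans (≤-trans (m≤m+n n₀ _) (<⇒≤ N≤n)) (m≤m*n n n {{>-nonZero 1≤n}}))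
            linkGraph
            (link-density n p (q * e) (length core) (edgeCount linkGraph) 1≤n 1≤p
              (≤-trans (m≤n+m _ n₀) (<⇒≤ N≤n)) dense′ linkGraph-edgeCount)
      in configuration-⊆ core⊆ (Growing.copy⇒configuration core core↑ linear H ord ord-inj back≤2
           (remQuot n ∘ f) (λ eq → f-inj (remQuot-injective n eq))
           -- The edge is reversed because a link starts at the later vertex.
           (λ {u} {v} uv → linkGraph-adj⁻ (f-hom v u (trans (symm H v u) uv)))
           τ (∑deficit≤ {t = t} {H} ∣H∣≡ (ord , ord-inj , back≤2)) e 1≤e (m≤n+m _ k₀)) })
  where
  τ = ℤ.∣ t ∣
  rearrange : ∀ q m e → q * (m * e) ≡ q * e * m
  rearrange = solve-∀
  remQuot-injective : ∀ n {i j : Fin (n * n)} → remQuot {n} n i ≡ remQuot n j → i ≡ j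
  remQuot-injective n {i} {j} eq = trans (sym (Fin.combine-remQuot {n} n i))
    (trans (cong (λ (x , y) → combine x y) eq) (Fin.combine-remQuot {n} n j))
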